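{- Let $L\dashv R\colon \mathbb{D}\to\mathbb{C}$ be an adjunction (so $L\colon\mathbb{C}\to\mathbb{D}$ is left adjoint to $R\colon\mathbb{D}\to\mathbb{C}$), let $F\colon\mathbb{C}\to\mathbb{C}$ and $G\colon\mathbb{D}\to\mathbb{D}$ be functors, and let $\tau\colon LF\Rightarrow GL$ be a natural transformation. Let $c$ be an $F$-coalgebra and $a$ an $F$-algebra. Suppose that there exists a $G$-algebra $a'$ such that $\mathrm{Alg}(R)(a')\cong a$ (as $F$-algebras). If the $G$-coalgebra $\mathrm{Coalg}(L)(c)$ is recursive, then there exists a unique ca-morphism from $c$ to $a$.
   Context: For a coalgebra $c\colon C\to FC$ and an algebra $a\colon FA\to A$ of the same endofunctor $F$, a ca-morphism from $c$ to $a$ is a morphism $i\colon C\to A$ with $i=a\circ Fi\circ c$. A coalgebra is recursive if for every algebra of the same endofunctor there is a unique ca-morphism from the coalgebra to that algebra. Let $\sigma\colon FR\Rightarrow RG$ be the mate of $\tau$ under $L\dashv R$, i.e. $\sigma_A$ is the adjoint transpose of $LFRA\xrightarrow{\tau_{RA}}GLRA\xrightarrow{G\varepsilon_A}GA$, where $\varepsilon$ is the counit. The functor $\mathrm{Coalg}(L)\colon\mathrm{Coalg}(F)\to\mathrm{Coalg}(G)$ sends $c\colon C\to FC$ to $\tau_C\circ L(c)\colon LC\to GLC$, and the functor $\mathrm{Alg}(R)\colon\mathrm{Alg}(G)\to\mathrm{Alg}(F)$ sends $a'\colon GA\to A$ to $R(a')\circ\sigma_A\colon FRA\to RA$. -}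

module Defs where

open import Level using (Level; _⊔_; suc)
open import Data.Product using (∃!)
open import Relation.Binary.Core using (Rel)
open import Relation.Binary.Bundles using (Setoid)
open import Relation.Binary.Structures using (IsEquivalence)
import Relation.Binary.Reasoning.Setoid as SetoidReasoning

-- There is no category theory in the standard library.  As is usual without
-- quotients, each hom-type carries its own equivalence relation _≈_, playing
-- the role of equality of morphisms; objects are never compared.
record Category (o ℓ e : Level) : Set (suc (o ⊔ ℓ ⊔ e)) where
  infix  4 _≈_ _⇒_
  infixr 9 _∘_
  field
    Obj : Set o
    _⇒_ : Obj → Obj → Set ℓ
    _≈_ : ∀ {A B} → Rel (A ⇒ B) e
    id  : ∀ {A} → A ⇒ A
    _∘_ : ∀ {A B C} → B ⇒ C → A ⇒ B → A ⇒ C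

    isEquivalence : ∀ {A B} → IsEquivalence (_≈_ {A} {B})
    ∘-cong        : ∀ {A B C} {f g : B ⇒ C} {h i : A ⇒ B} →
                    f ≈ g → h ≈ i → f ∘ h ≈ g ∘ i
    assoc         : ∀ {A B C D} {f : A ⇒ B} {g : B ⇒ C} {h : C ⇒ D} →
                    (h ∘ g) ∘ f ≈ h ∘ (g ∘ f)
    identityˡ     : ∀ {A B} {f : A ⇒ B} → id ∘ f ≈ f
    identityʳ     : ∀ {A B} {f : A ⇒ B} → f ∘ id ≈ f

  hom-setoid : Obj → Obj → Setoid ℓ e
  hom-setoid A B = record
    { Carrier = A ⇒ B ; _≈_ = _≈_ ; isEquivalence = isEquivalence }

  module Hom {A B : Obj} where
    open IsEquivalence (isEquivalence {A} {B}) public using (refl; sym; trans)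
    open SetoidReasoning (hom-setoid A B) public

record Iso {o ℓ e : Level} (C : Category o ℓ e) (A B : Category.Obj C)
         : Set (ℓ ⊔ e) where
  open Category C
  field
    to   : A ⇒ B
    from : B ⇒ A
    isoˡ : from ∘ to ≈ id
    isoʳ : to ∘ from ≈ id

infix 4 _[_≅_]
_[_≅_] : {o ℓ e : Level} (C : Category o ℓ e) →
         Category.Obj C → Category.Obj C → Set (ℓ ⊔ e)
C [ A ≅ B ] = Iso C A B

record Functor {o ℓ e o′ ℓ′ e′ : Level}
               (C : Category o ℓ e) (D : Category o′ ℓ′ e′)
             : Set (o ⊔ ℓ ⊔ e ⊔ o′ ⊔ ℓ′ ⊔ e′) where
  private
    module C = Category C
    module D = Category D
  field
    F₀       : C.Obj → D.Obj
    F₁       : ∀ {A B} → A C.⇒ B → F₀ A D.⇒ F₀ B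
    F-cong   : ∀ {A B} {f g : A C.⇒ B} → f C.≈ g → F₁ f D.≈ F₁ g
    identity : ∀ {A} → F₁ (C.id {A}) D.≈ D.id
    homo     : ∀ {X Y Z} {f : X C.⇒ Y} {g : Y C.⇒ Z} →
               F₁ (g C.∘ f) D.≈ F₁ g D.∘ F₁ f

Endofunctor : {o ℓ e : Level} → Category o ℓ e → Set (o ⊔ ℓ ⊔ e)
Endofunctor C = Functor C C

idF : {o ℓ e : Level} (C : Category o ℓ e) → Functor C C
idF C = record
  { F₀ = λ A → A ; F₁ = λ f → f ; F-cong = λ p → p
  ; identity = Hom.refl ; homo = Hom.refl }
  where open Category C

infixr 9 _∘F_
_∘F_ : {o ℓ e o′ ℓ′ e′ o″ ℓ″ e″ : Level} {C : Category o ℓ e}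
       {D : Category o′ ℓ′ e′} {E : Category o″ ℓ″ e″} →
       Functor D E → Functor C D → Functor C E
_∘F_ {E = E} G F = record
  { F₀       = λ A → G.F₀ (F.F₀ A)
  ; F₁       = λ f → G.F₁ (F.F₁ f)
  ; F-cong   = λ p → G.F-cong (F.F-cong p)
  ; identity = Hom.trans (G.F-cong F.identity) G.identity
  ; homo     = Hom.trans (G.F-cong F.homo) G.homo
  }
  where
    module F = Functor F
    module G = Functor G
    open Category E

record NaturalTransformation {o ℓ e o′ ℓ′ e′ : Level}
         {C : Category o ℓ e} {D : Category o′ ℓ′ e′} (F G : Functor C D)
         : Set (o ⊔ ℓ ⊔ ℓ′ ⊔ e′) where
  private
    module C = Category C
    module F = Functor F
    module G = Functor G
  open Category D
  field
    η       : ∀ A → F.F₀ A ⇒ G.F₀ A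
    natural : ∀ {A B} (f : A C.⇒ B) → η B ∘ F.F₁ f ≈ G.F₁ f ∘ η A

infix 5 _⊣_
record _⊣_ {o ℓ e o′ ℓ′ e′ : Level}
           {C : Category o ℓ e} {D : Category o′ ℓ′ e′}
           (L : Functor C D) (R : Functor D C)
         : Set (o ⊔ ℓ ⊔ e ⊔ o′ ⊔ ℓ′ ⊔ e′) where
  private
    module C = Category C
    module D = Category D
    module L = Functor L
    module R = Functor R
  field
    unit   : NaturalTransformation (idF C) (R ∘F L)
    counit : NaturalTransformation (L ∘F R) (idF D)

  module unit = NaturalTransformation unit
  module counit = NaturalTransformation counit

  field
    zig : ∀ {A} → counit.η (L.F₀ A) D.∘ L.F₁ (unit.η A) D.≈ D.id
    zag : ∀ {B} → R.F₁ (counit.η B) C.∘ unit.η (R.F₀ B) C.≈ C.id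

  -- The adjoint transpose D(LA,B) → C(A,RB), f ↦ Rf ∘ η, where η is the unit.
  transpose : ∀ {A B} → L.F₀ A D.⇒ B → A C.⇒ R.F₀ B
  transpose {A} f = R.F₁ f C.∘ unit.η A

  transpose-cong : ∀ {A B} {f g : L.F₀ A D.⇒ B} → f D.≈ g →
                   transpose f C.≈ transpose g
  transpose-cong p = C.∘-cong (R.F-cong p) C.Hom.refl

  transpose-post : ∀ {A B B′} {f : L.F₀ A D.⇒ B} {g : B D.⇒ B′} →
                   transpose (g D.∘ f) C.≈ R.F₁ g C.∘ transpose f
  transpose-post = C.Hom.trans (C.∘-cong R.homo C.Hom.refl) C.assoc

  transpose-pre : ∀ {A A′ B} {f : L.F₀ A D.⇒ B} {h : A′ C.⇒ A} →
                  transpose (f D.∘ L.F₁ h) C.≈ transpose f C.∘ h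
  transpose-pre {A} {A′} {B} {f} {h} = begin
    R.F₁ (f D.∘ L.F₁ h) C.∘ unit.η A′       ≈⟨ transpose-post ⟩
    R.F₁ f C.∘ (R.F₁ (L.F₁ h) C.∘ unit.η A′) ≈⟨ C.∘-cong C.Hom.refl (unit.natural h) ⟨
    R.F₁ f C.∘ (unit.η A C.∘ h)             ≈⟨ C.assoc ⟨
    (R.F₁ f C.∘ unit.η A) C.∘ h             ∎
    where open C.Hom

module _ {o ℓ e : Level} {C : Category o ℓ e} (F : Endofunctor C) where
  open Category C
  open Functor F

  record Algebra : Set (o ⊔ ℓ) where
    constructor algebra
    field
      {carrier} : Obj
      structure : F₀ carrier ⇒ carrier

  record Coalgebra : Set (o ⊔ ℓ) where
    constructor coalgebra
    field
      {carrier} : Obj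
      structure : carrier ⇒ F₀ carrier

  record AlgebraHom (a b : Algebra) : Set (ℓ ⊔ e) where
    private
      module a = Algebra a
      module b = Algebra b
    field
      morphism : a.carrier ⇒ b.carrier
      commutes : morphism ∘ a.structure ≈ b.structure ∘ F₁ morphism

  record CoalgebraHom (c d : Coalgebra) : Set (ℓ ⊔ e) where
    private
      module c = Coalgebra c
      module d = Coalgebra d
    field
      morphism : c.carrier ⇒ d.carrier
      commutes : d.structure ∘ morphism ≈ F₁ morphism ∘ c.structure

  Alg : Category (o ⊔ ℓ) (ℓ ⊔ e) e
  Alg = record
    { Obj = Algebra
    ; _⇒_ = AlgebraHom
    ; _≈_ = λ f g → morphism f ≈ morphism g
    ; id  = record
      { morphism = id
      ; commutes = Hom.trans identityˡ
          (Hom.trans (Hom.sym identityʳ) (∘-cong Hom.refl (Hom.sym identity)))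
      }
    ; _∘_ = λ {a} {b} {d} g f → record
      { morphism = morphism g ∘ morphism f
      ; commutes = let open Hom in begin
          (morphism g ∘ morphism f) ∘ structure a           ≈⟨ assoc ⟩
          morphism g ∘ (morphism f ∘ structure a)           ≈⟨ ∘-cong Hom.refl (commutes f) ⟩
          morphism g ∘ (structure b ∘ F₁ (morphism f))      ≈⟨ assoc ⟨
          (morphism g ∘ structure b) ∘ F₁ (morphism f)      ≈⟨ ∘-cong (commutes g) Hom.refl ⟩
          (structure d ∘ F₁ (morphism g)) ∘ F₁ (morphism f) ≈⟨ assoc ⟩
          structure d ∘ (F₁ (morphism g) ∘ F₁ (morphism f)) ≈⟨ ∘-cong Hom.refl homo ⟨
          structure d ∘ F₁ (morphism g ∘ morphism f)        ∎
      }
    ; isEquivalence = record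
      { refl = Hom.refl ; sym = Hom.sym ; trans = Hom.trans }
    ; ∘-cong = ∘-cong
    ; assoc = assoc
    ; identityˡ = identityˡ
    ; identityʳ = identityʳ
    }
    where
      open Algebra using (structure)
      open AlgebraHom

  Coalg : Category (o ⊔ ℓ) (ℓ ⊔ e) e
  Coalg = record
    { Obj = Coalgebra
    ; _⇒_ = CoalgebraHom
    ; _≈_ = λ f g → morphism f ≈ morphism g
    ; id  = record
      { morphism = id
      ; commutes = Hom.trans identityʳ
          (Hom.trans (Hom.sym identityˡ) (∘-cong (Hom.sym identity) Hom.refl))
      }
    ; _∘_ = λ {a} {b} {d} g f → record
      { morphism = morphism g ∘ morphism f
      ; commutes = let open Hom in begin
          structure d ∘ (morphism g ∘ morphism f)           ≈⟨ assoc ⟨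
          (structure d ∘ morphism g) ∘ morphism f           ≈⟨ ∘-cong (commutes g) Hom.refl ⟩
          (F₁ (morphism g) ∘ structure b) ∘ morphism f      ≈⟨ assoc ⟩
          F₁ (morphism g) ∘ (structure b ∘ morphism f)      ≈⟨ ∘-cong Hom.refl (commutes f) ⟩
          F₁ (morphism g) ∘ (F₁ (morphism f) ∘ structure a) ≈⟨ assoc ⟨
          (F₁ (morphism g) ∘ F₁ (morphism f)) ∘ structure a ≈⟨ ∘-cong homo Hom.refl ⟨
          F₁ (morphism g ∘ morphism f) ∘ structure a        ∎
      }
    ; isEquivalence = record
      { refl = Hom.refl ; sym = Hom.sym ; trans = Hom.trans }
    ; ∘-cong = ∘-cong
    ; assoc = assoc
    ; identityˡ = identityˡ
    ; identityʳ = identityʳ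
    }
    where
      open Coalgebra using (structure)
      open CoalgebraHom

module _ {o ℓ e : Level} {C : Category o ℓ e} {F : Endofunctor C} where
  open Category C
  open Functor F

  IsCaMorphism : (c : Coalgebra F) (a : Algebra F) →
                 Coalgebra.carrier c ⇒ Algebra.carrier a → Set e
  IsCaMorphism c a i = i ≈ Algebra.structure a ∘ (F₁ i ∘ Coalgebra.structure c)

  UniqueCaMorphism : Coalgebra F → Algebra F → Set (ℓ ⊔ e)
  UniqueCaMorphism c a = ∃! _≈_ (IsCaMorphism c a)

  Recursive : Coalgebra F → Set (o ⊔ ℓ ⊔ e)
  Recursive c = (a : Algebra F) → UniqueCaMorphism c a

module _ {o ℓ e o′ ℓ′ e′ : Level}
         {C : Category o ℓ e} {D : Category o′ ℓ′ e′}
         (L : Functor C D) (F : Endofunctor C) (G : Endofunctor D)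
         (τ : NaturalTransformation (L ∘F F) (G ∘F L)) where
  private
    module L = Functor L
    module F = Functor F
    module G = Functor G
    module τ = NaturalTransformation τ

  -- The functor Coalg(L).
  Coalg-map : Functor (Coalg F) (Coalg G)
  Coalg-map = record
    { F₀ = λ c → coalgebra (τ.η (carrier c) ∘ L.F₁ (structure c))
    ; F₁ = λ {c} {d} f → record
      { morphism = L.F₁ (morphism f)
      ; commutes = let open Hom in begin
          (τ.η (carrier d) ∘ L.F₁ (structure d)) ∘ L.F₁ (morphism f)
            ≈⟨ assoc ⟩
          τ.η (carrier d) ∘ (L.F₁ (structure d) ∘ L.F₁ (morphism f))
            ≈⟨ ∘-cong Hom.refl L.homo ⟨
          τ.η (carrier d) ∘ L.F₁ (structure d C.∘ morphism f)
            ≈⟨ ∘-cong Hom.refl (L.F-cong (commutes f)) ⟩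
          τ.η (carrier d) ∘ L.F₁ (F.F₁ (morphism f) C.∘ structure c)
            ≈⟨ ∘-cong Hom.refl L.homo ⟩
          τ.η (carrier d) ∘ (L.F₁ (F.F₁ (morphism f)) ∘ L.F₁ (structure c))
            ≈⟨ assoc ⟨
          (τ.η (carrier d) ∘ L.F₁ (F.F₁ (morphism f))) ∘ L.F₁ (structure c)
            ≈⟨ ∘-cong (τ.natural (morphism f)) Hom.refl ⟩
          (G.F₁ (L.F₁ (morphism f)) ∘ τ.η (carrier c)) ∘ L.F₁ (structure c)
            ≈⟨ assoc ⟩
          G.F₁ (L.F₁ (morphism f)) ∘ (τ.η (carrier c) ∘ L.F₁ (structure c))
            ∎
      }
    ; F-cong   = L.F-cong
    ; identity = L.identity
    ; homo     = L.homo
    }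
    where
      module C = Category C
      open Category D
      open Coalgebra
      open CoalgebraHom

  module _ {R : Functor D C} (L⊣R : L ⊣ R) where
    private
      module C = Category C
      module D = Category D
      module R = Functor R
      open _⊣_ L⊣R

    -- σ : FR ⇒ RG, the transpose of LFRA → GLRA → GA.
    mate : NaturalTransformation (F ∘F R) (R ∘F G)
    mate = record
      { η       = λ A → transpose (preMate A)
      ; natural = λ {A} {B} f → let open C.Hom in begin
          transpose (preMate B) C.∘ F.F₁ (R.F₁ f)          ≈⟨ transpose-pre ⟨
          transpose (preMate B D.∘ L.F₁ (F.F₁ (R.F₁ f)))   ≈⟨ transpose-cong (preMate-natural f) ⟩
          transpose (G.F₁ f D.∘ preMate A)                 ≈⟨ transpose-post ⟩
          R.F₁ (G.F₁ f) C.∘ transpose (preMate A)          ∎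
      }
      where
        preMate : ∀ A → L.F₀ (F.F₀ (R.F₀ A)) D.⇒ G.F₀ A
        preMate A = G.F₁ (counit.η A) D.∘ τ.η (R.F₀ A)

        preMate-natural : ∀ {A B} (f : A D.⇒ B) →
          preMate B D.∘ L.F₁ (F.F₁ (R.F₁ f)) D.≈ G.F₁ f D.∘ preMate A
        preMate-natural {A} {B} f = let open D.Hom in begin
          (G.F₁ (counit.η B) D.∘ τ.η (R.F₀ B)) D.∘ L.F₁ (F.F₁ (R.F₁ f))
            ≈⟨ D.assoc ⟩
          G.F₁ (counit.η B) D.∘ (τ.η (R.F₀ B) D.∘ L.F₁ (F.F₁ (R.F₁ f)))
            ≈⟨ D.∘-cong D.Hom.refl (τ.natural (R.F₁ f)) ⟩
          G.F₁ (counit.η B) D.∘ (G.F₁ (L.F₁ (R.F₁ f)) D.∘ τ.η (R.F₀ A))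
            ≈⟨ D.assoc ⟨
          (G.F₁ (counit.η B) D.∘ G.F₁ (L.F₁ (R.F₁ f))) D.∘ τ.η (R.F₀ A)
            ≈⟨ D.∘-cong G.homo D.Hom.refl ⟨
          G.F₁ (counit.η B D.∘ L.F₁ (R.F₁ f)) D.∘ τ.η (R.F₀ A)
            ≈⟨ D.∘-cong (G.F-cong (counit.natural f)) D.Hom.refl ⟩
          G.F₁ (f D.∘ counit.η A) D.∘ τ.η (R.F₀ A)
            ≈⟨ D.∘-cong G.homo D.Hom.refl ⟩
          (G.F₁ f D.∘ G.F₁ (counit.η A)) D.∘ τ.η (R.F₀ A)
            ≈⟨ D.assoc ⟩
          G.F₁ f D.∘ (G.F₁ (counit.η A) D.∘ τ.η (R.F₀ A))
            ∎

    private module σ = NaturalTransformation mate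

    -- The functor Alg(R).
    Alg-map : Functor (Alg G) (Alg F)
    Alg-map = record
      { F₀ = λ a → algebra (R.F₁ (structure a) ∘ σ.η (carrier a))
      ; F₁ = λ {a} {b} f → record
        { morphism = R.F₁ (morphism f)
        ; commutes = let open Hom in begin
            R.F₁ (morphism f) ∘ (R.F₁ (structure a) ∘ σ.η (carrier a))
              ≈⟨ assoc ⟨
            (R.F₁ (morphism f) ∘ R.F₁ (structure a)) ∘ σ.η (carrier a)
              ≈⟨ ∘-cong R.homo Hom.refl ⟨
            R.F₁ (morphism f D.∘ structure a) ∘ σ.η (carrier a)
              ≈⟨ ∘-cong (R.F-cong (commutes f)) Hom.refl ⟩
            R.F₁ (structure b D.∘ G.F₁ (morphism f)) ∘ σ.η (carrier a)
              ≈⟨ ∘-cong R.homo Hom.refl ⟩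
            (R.F₁ (structure b) ∘ R.F₁ (G.F₁ (morphism f))) ∘ σ.η (carrier a)
              ≈⟨ assoc ⟩
            R.F₁ (structure b) ∘ (R.F₁ (G.F₁ (morphism f)) ∘ σ.η (carrier a))
              ≈⟨ ∘-cong Hom.refl (σ.natural (morphism f)) ⟨
            R.F₁ (structure b) ∘ (σ.η (carrier b) ∘ F.F₁ (R.F₁ (morphism f)))
              ≈⟨ assoc ⟨
            (R.F₁ (structure b) ∘ σ.η (carrier b)) ∘ F.F₁ (R.F₁ (morphism f))
              ∎
        }
      ; F-cong   = R.F-cong
      ; identity = R.identity
      ; homo     = R.homo
      }
      where
        open Category C
        open Algebra
        open AlgebraHom

-- A ca-morphism LC → A from Coalg(L)(c) to a′ is, under transposition, the same
-- thing as a ca-morphism C → RA from c to Alg(R)(a′): transposing the right-hand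
-- side a′ ∘ Gi ∘ τ ∘ Lc of the defining equation for i gives the right-hand side
-- of the defining equation for the transpose of i.  Existence and uniqueness
-- therefore pass from a′ to Alg(R)(a′), and then along the isomorphism to a.

module Submission where

open import Defs
open import Level using (Level)
open import Data.Product using (∃-syntax; _,_)

module _ {o ℓ e : Level} {C : Category o ℓ e} {F : Endofunctor C} where
  open Category C
  open Functor F

  -- Morphisms are compared only up to `_≈_`, so the defining equation must be transported
  -- explicitly; this is what later allows `h` to be replaced by `transpose (untranspose h)`.
  IsCaMorphism-resp-≈ : {c : Coalgebra F} {a : Algebra F}
    {i j : Coalgebra.carrier c ⇒ Algebra.carrier a} →
    i ≈ j → IsCaMorphism {F = F} c a i → IsCaMorphism {F = F} c a j
  IsCaMorphism-resp-≈ i≈j i-ca =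
    Hom.trans (Hom.sym i≈j)
      (Hom.trans i-ca (∘-cong Hom.refl (∘-cong (F-cong i≈j) Hom.refl)))

  -- The square of `f` is pasted onto the defining equation of `i`, and functoriality merges the two
  -- images under `F`.
  AlgebraHom-∘-IsCaMorphism : {c : Coalgebra F} {a b : Algebra F}
    (f : AlgebraHom F a b) {i : Coalgebra.carrier c ⇒ Algebra.carrier a} →
    IsCaMorphism {F = F} c a i →
    IsCaMorphism {F = F} c b (AlgebraHom.morphism f ∘ i)
  AlgebraHom-∘-IsCaMorphism {coalgebra γ} {algebra α} {algebra β} f {i} i-ca = begin
    m ∘ i                 ≈⟨ ∘-cong Hom.refl i-ca ⟩
    m ∘ (α ∘ (F₁ i ∘ γ))  ≈⟨ assoc ⟨
    (m ∘ α) ∘ (F₁ i ∘ γ)  ≈⟨ ∘-cong (AlgebraHom.commutes f) Hom.refl ⟩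
    (β ∘ F₁ m) ∘ (F₁ i ∘ γ) ≈⟨ assoc ⟩
    β ∘ (F₁ m ∘ (F₁ i ∘ γ)) ≈⟨ ∘-cong Hom.refl assoc ⟨
    β ∘ ((F₁ m ∘ F₁ i) ∘ γ) ≈⟨ ∘-cong Hom.refl (∘-cong homo Hom.refl) ⟨
    β ∘ (F₁ (m ∘ i) ∘ γ)  ∎
    where
      open Hom
      m = AlgebraHom.morphism f

  UniqueCaMorphism-resp-≅ : {c : Coalgebra F} {a b : Algebra F} →
    Alg F [ a ≅ b ] →
    UniqueCaMorphism {F = F} c a → UniqueCaMorphism {F = F} c b
  UniqueCaMorphism-resp-≅ {c} {a} {b} a≅b (i , i-ca , i-unique) =
    to.morphism ∘ i , AlgebraHom-∘-IsCaMorphism {c} {a} {b} to i-ca , λ {j} j-ca → begin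
      to.morphism ∘ i
        -- A competitor `j` into `b` is pulled back along `from`, where uniqueness for `a`
        -- identifies it with `i`.
        ≈⟨ ∘-cong Hom.refl (i-unique (AlgebraHom-∘-IsCaMorphism {c} {b} {a} from j-ca)) ⟩
      to.morphism ∘ (from.morphism ∘ j)
        ≈⟨ assoc ⟨
      (to.morphism ∘ from.morphism) ∘ j
        ≈⟨ ∘-cong isoʳ Hom.refl ⟩
      id ∘ j
        ≈⟨ identityˡ ⟩
      j ∎
    where
      open Hom
      open Iso a≅b
      module to = AlgebraHom to
      module from = AlgebraHom from

module _ {o ℓ e o′ ℓ′ e′ : Level}
         {C : Category o ℓ e} {D : Category o′ ℓ′ e′}
         {L : Functor C D} {R : Functor D C} (L⊣R : L ⊣ R) where
  private
    module C = Category C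
    module D = Category D
    module L = Functor L
    module R = Functor R
  open _⊣_ L⊣R

  untranspose : ∀ {A B} → A C.⇒ R.F₀ B → L.F₀ A D.⇒ B
  untranspose {B = B} h = counit.η B D.∘ L.F₁ h

  -- Naturality of the counit moves `f` to the front, leaving the triangle `zig`.
  untranspose-transpose : ∀ {A B} (f : L.F₀ A D.⇒ B) →
                          untranspose (transpose f) D.≈ f
  untranspose-transpose {A} {B} f = begin
    counit.η B D.∘ L.F₁ (R.F₁ f C.∘ unit.η A)
      ≈⟨ D.∘-cong D.Hom.refl L.homo ⟩
    counit.η B D.∘ (L.F₁ (R.F₁ f) D.∘ L.F₁ (unit.η A))
      ≈⟨ D.assoc ⟨
    (counit.η B D.∘ L.F₁ (R.F₁ f)) D.∘ L.F₁ (unit.η A)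
      ≈⟨ D.∘-cong (counit.natural f) D.Hom.refl ⟩
    (f D.∘ counit.η (L.F₀ A)) D.∘ L.F₁ (unit.η A)
      ≈⟨ D.assoc ⟩
    f D.∘ (counit.η (L.F₀ A) D.∘ L.F₁ (unit.η A))
      ≈⟨ D.∘-cong D.Hom.refl zig ⟩
    f D.∘ D.id
      ≈⟨ D.identityʳ ⟩
    f ∎
    where open D.Hom

  transpose-untranspose : ∀ {A B} (h : A C.⇒ R.F₀ B) →
                          transpose (untranspose h) C.≈ h
  transpose-untranspose h =
    C.Hom.trans transpose-pre
      (C.Hom.trans (C.∘-cong zag C.Hom.refl) C.identityˡ)

  -- Since `untranspose` is a left inverse, an equation in `D` may be checked after transposing it
  -- to `C`.
  transpose-injective : ∀ {A B} {f g : L.F₀ A D.⇒ B} →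
                        transpose f C.≈ transpose g → f D.≈ g
  transpose-injective {f = f} {g} p = begin
    f                         ≈⟨ untranspose-transpose f ⟨
    untranspose (transpose f) ≈⟨ D.∘-cong D.Hom.refl (L.F-cong p) ⟩
    untranspose (transpose g) ≈⟨ untranspose-transpose g ⟩
    g ∎
    where open D.Hom

  module _ (F : Endofunctor C) (G : Endofunctor D)
           (τ : NaturalTransformation (L ∘F F) (G ∘F L)) where
    private
      module F = Functor F
      module G = Functor G
      module τ = NaturalTransformation τ
      module σ = NaturalTransformation (mate L F G τ L⊣R)
      module CoalgL = Functor (Coalg-map L F G τ)
      module AlgR = Functor (Alg-map L F G τ L⊣R)

    -- The key compatibility of σ with transposition: naturality of τ brings `L.F₁ (transpose i)`
    -- next to the counit hidden in σ, and the two collapse to `i`.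
    mate-transpose : ∀ {A B} (i : L.F₀ A D.⇒ B) →
      σ.η B C.∘ F.F₁ (transpose i) C.≈ transpose (G.F₁ i D.∘ τ.η A)
    mate-transpose {A} {B} i =
      -- `σ.η B` is itself a transpose, so it absorbs the precomposed morphism and the calculation
      -- moves to `D`.
      C.Hom.trans (C.Hom.sym transpose-pre) (transpose-cong (begin
        (G.F₁ (counit.η B) D.∘ τ.η (R.F₀ B)) D.∘ L.F₁ (F.F₁ (transpose i))
          ≈⟨ D.assoc ⟩
        G.F₁ (counit.η B) D.∘ (τ.η (R.F₀ B) D.∘ L.F₁ (F.F₁ (transpose i)))
          ≈⟨ D.∘-cong D.Hom.refl (τ.natural (transpose i)) ⟩
        G.F₁ (counit.η B) D.∘ (G.F₁ (L.F₁ (transpose i)) D.∘ τ.η A)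
          ≈⟨ D.assoc ⟨
        (G.F₁ (counit.η B) D.∘ G.F₁ (L.F₁ (transpose i))) D.∘ τ.η A
          ≈⟨ D.∘-cong G.homo D.Hom.refl ⟨
        G.F₁ (untranspose (transpose i)) D.∘ τ.η A
          ≈⟨ D.∘-cong (G.F-cong (untranspose-transpose i)) D.Hom.refl ⟩
        G.F₁ i D.∘ τ.η A ∎))
      where open D.Hom

    module _ (c : Coalgebra F) (a : Algebra G) where
      open Coalgebra c using () renaming (carrier to X; structure to γ)
      open Algebra a using () renaming (carrier to A; structure to α)

      -- Naturality of transposition in codomain and domain splits off `α` and `γ`; `mate-transpose`
      -- handles what remains between them.
      transpose-ca-equation : (i : L.F₀ X D.⇒ A) →
        transpose (α D.∘ (G.F₁ i D.∘ (τ.η X D.∘ L.F₁ γ))) C.≈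
        (R.F₁ α C.∘ σ.η A) C.∘ (F.F₁ (transpose i) C.∘ γ)
      transpose-ca-equation i = begin
        transpose (α D.∘ (G.F₁ i D.∘ (τ.η X D.∘ L.F₁ γ)))
          ≈⟨ transpose-post ⟩
        R.F₁ α C.∘ transpose (G.F₁ i D.∘ (τ.η X D.∘ L.F₁ γ))
          ≈⟨ C.∘-cong C.Hom.refl (transpose-cong D.assoc) ⟨
        R.F₁ α C.∘ transpose ((G.F₁ i D.∘ τ.η X) D.∘ L.F₁ γ)
          ≈⟨ C.∘-cong C.Hom.refl transpose-pre ⟩
        R.F₁ α C.∘ (transpose (G.F₁ i D.∘ τ.η X) C.∘ γ)
          ≈⟨ C.∘-cong C.Hom.refl (C.∘-cong (mate-transpose i) C.Hom.refl) ⟨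
        R.F₁ α C.∘ ((σ.η A C.∘ F.F₁ (transpose i)) C.∘ γ)
          ≈⟨ C.∘-cong C.Hom.refl C.assoc ⟩
        R.F₁ α C.∘ (σ.η A C.∘ (F.F₁ (transpose i) C.∘ γ))
          ≈⟨ C.assoc ⟨
        (R.F₁ α C.∘ σ.η A) C.∘ (F.F₁ (transpose i) C.∘ γ) ∎
        where open C.Hom

      transpose-isCaMorphism : {i : L.F₀ X D.⇒ A} →
        IsCaMorphism {F = G} (CoalgL.F₀ c) a i →
        IsCaMorphism {F = F} c (AlgR.F₀ a) (transpose i)
      transpose-isCaMorphism {i} i-ca =
        C.Hom.trans (transpose-cong i-ca) (transpose-ca-equation i)

      transpose-isCaMorphism⁻¹ : {i : L.F₀ X D.⇒ A} →
        IsCaMorphism {F = F} c (AlgR.F₀ a) (transpose i) →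
        IsCaMorphism {F = G} (CoalgL.F₀ c) a i
      transpose-isCaMorphism⁻¹ {i} ti-ca =
        transpose-injective
          (C.Hom.trans ti-ca (C.Hom.sym (transpose-ca-equation i)))

      untranspose-isCaMorphism : {h : X C.⇒ R.F₀ A} →
        IsCaMorphism {F = F} c (AlgR.F₀ a) h →
        IsCaMorphism {F = G} (CoalgL.F₀ c) a (untranspose h)
      untranspose-isCaMorphism {h} h-ca =
        transpose-isCaMorphism⁻¹
          (IsCaMorphism-resp-≈ {c = c} {a = AlgR.F₀ a}
            (C.Hom.sym (transpose-untranspose h)) h-ca)

      transpose-uniqueCaMorphism :
        UniqueCaMorphism {F = G} (CoalgL.F₀ c) a →
        UniqueCaMorphism {F = F} c (AlgR.F₀ a)
      transpose-uniqueCaMorphism (i , i-ca , i-unique) =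
        -- Uniqueness: `untranspose h` solves the equation in `D`, so it equals `i`; transposing
        -- back recovers `h`.
        transpose i , transpose-isCaMorphism i-ca , λ {h} h-ca →
          C.Hom.trans
            (transpose-cong (i-unique (untranspose-isCaMorphism h-ca)))
            (transpose-untranspose h)

proposition2p4 : {o ℓ e o′ ℓ′ e′ : Level} (C : Category o ℓ e) (D : Category o′ ℓ′ e′)
    (L : Functor C D) (R : Functor D C) (L⊣R : L ⊣ R)
    (F : Endofunctor C) (G : Endofunctor D)
    (τ : NaturalTransformation (L ∘F F) (G ∘F L))
    (c : Coalgebra F) (a : Algebra F) →
    (∃[ a′ ] Alg F [ Functor.F₀ (Alg-map L F G τ L⊣R) a′ ≅ a ]) →
    Recursive (Functor.F₀ (Coalg-map L F G τ) c) →
    UniqueCaMorphism c a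
proposition2p4 C D L R L⊣R F G τ c a (a′ , Ra′≅a) Lc-recursive =
  UniqueCaMorphism-resp-≅ {c = c} Ra′≅a
    (transpose-uniqueCaMorphism L⊣R F G τ c a′ (Lc-recursive a′))
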